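{- Let $\mathcal B_{\mathcal E}$ be the set of partitions $\beta_1+\cdots+\beta_n$ ($0<\beta_1\le\cdots\le\beta_n$) with $\beta_1\in\{2,3\}$ and, for each $2\le i\le n$: if $\beta_i$ is odd then $3\le\beta_i-\beta_{i-1}\le4$, and if $\beta_i$ is even then $0\le\beta_i-\beta_{i-1}\le1$. Let $b_{\mathcal E}(n)=\sum q^{|\beta|}$ over $\beta\in\mathcal B_{\mathcal E}$ with exactly $n$ parts ($b_{\mathcal E}(0)=1$). Then $$\sum_{n\ge0}\frac{b_{\mathcal E}(n)}{(q^2;q^2)_n}=1+\frac{q^2+q^3}{1-q^2}+\sum_{n\ge2}\frac{(-q^3;q^4)_{n-1}\,q^{2n}(1+q^{2n-1})}{(q^2;q^2)_n}.$$
   Context: $(a;q)_n=\prod_{j=0}^{n-1}(1-aq^j)$; $|\beta|$ is the sum of parts. -}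

module Defs where

open import Algebra.Bundles.Raw using (RawRing)
open import Data.Fin.Base using (zero; suc; toℕ)
open import Data.Integer.Base as ℤ using (ℤ; 0ℤ; 1ℤ)
import Data.Integer.Properties as ℤ
open import Data.List.Base
  using (List; []; _∷_; length; head; filter; upTo; cartesianProductWith)
open import Data.List.Membership.Propositional using (_∈_)
open import Data.List.Membership.Propositional.Properties
  using (∈-cartesianProductWith⁺; ∈-cartesianProductWith⁻; ∈-upTo⁺; ∈-filter⁺; ∈-filter⁻)
open import Data.List.Properties using (∷-injective)
open import Data.List.Relation.Unary.All as All using (All; []; _∷_)
open import Data.List.Relation.Unary.Any using (here)
open import Data.List.Relation.Unary.Linked using (Linked; linked?)
open import Data.List.Relation.Unary.AllPairs using ([]; _∷_)
open import Data.List.Relation.Unary.Unique.Propositional using (Unique)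
import Data.List.Relation.Unary.Unique.Propositional.Properties as Unique
import Data.Maybe.Relation.Unary.All as Maybe
open import Data.Nat.Base as ℕ using (ℕ; zero; suc; _∸_; _≤_; _<_; s≤s)
open import Data.Nat.Divisibility using (_∣_; _∣?_)
open import Data.Nat.ListAction using () renaming (sum to weight)
import Data.Nat.Properties as ℕ
open import Data.Product.Base using (_×_; _,_; ∃-syntax)
open import Data.Sum.Base using (_⊎_)
open import Data.Vec.Functional using (Vector) renaming (_∷_ to _◂_)
open import Function.Bundles using (_⇔_; mk⇔)
open import Level using (0ℓ)
open import Relation.Binary.PropositionalEquality
open import Relation.Nullary using (¬_; ¬?)
open import Relation.Nullary.Decidable using (_×-dec_; _⊎-dec_; _→-dec_)
import Relation.Binary.Definitions as Binary
open import Relation.Unary using (Decidable)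

import Algebra.Definitions.RawSemiring as RawSemiringDefinitions
open import Algebra.Properties.Semiring.Sum ℤ.+-*-semiring
  using (sum-cong-≗) renaming (sum to sumℤ)

-- ℤ[[q]]: f n is the coefficient of qⁿ.
PowerSeries : Set
PowerSeries = ℕ → ℤ

private
  cauchy : PowerSeries → PowerSeries → PowerSeries
  cauchy f g n = sumℤ {suc n} λ i → f (toℕ i) ℤ.* g (n ∸ toℕ i)

  one : PowerSeries
  one zero    = 1ℤ
  one (suc _) = 0ℤ

powerSeriesRawRing : RawRing 0ℓ 0ℓ
powerSeriesRawRing = record
  { Carrier = PowerSeries
  ; _≈_     = _≗_
  ; _+_     = λ f g n → f n ℤ.+ g n
  ; _*_     = cauchy
  ; -_      = λ f n → ℤ.- f n
  ; 0#      = λ _ → 0ℤ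
  ; 1#      = one
  }

open RawRing powerSeriesRawRing public
  using (_≈_; _+_; _*_; -_; 0#; 1#; rawSemiring)
open RawSemiringDefinitions rawSemiring public using (_^_; sum)

infixl 6 _-_
_-_ : PowerSeries → PowerSeries → PowerSeries
f - g = f + - g

q : PowerSeries
q 1 = 1ℤ
q _ = 0ℤ

-- The coefficients n, n-1, …, 0 (in this order) of the multiplicative
-- inverse of f, from the usual recurrence
-- f⁻¹ₙ = - Σ_{1 ≤ i ≤ n} fᵢ f⁻¹ₙ₋ᵢ, valid when f has constant
-- coefficient 1.
inverseTo : PowerSeries → (n : ℕ) → Vector ℤ (suc n)
inverseTo f zero    = λ _ → 1ℤ
inverseTo f (suc n) =
  (ℤ.- sumℤ {suc n} (λ i → f (suc (toℕ i)) ℤ.* inverseTo f n i)) ◂ inverseTo f n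

-- Meaningful only for f with constant coefficient 1; see *-inverseʳ.
inverse : PowerSeries → PowerSeries
inverse f n = inverseTo f n zero

infixl 7 _/_
_/_ : PowerSeries → PowerSeries → PowerSeries
f / g = f * inverse g

inverseTo-inverse : ∀ f n i → inverseTo f n i ≡ inverse f (n ∸ toℕ i)
inverseTo-inverse f zero    zero    = refl
inverseTo-inverse f (suc n) zero    = refl
inverseTo-inverse f (suc n) (suc i) = inverseTo-inverse f n i

*-inverseʳ : ∀ f → f 0 ≡ 1ℤ → f * inverse f ≈ 1#
*-inverseʳ f f₀≡1 zero    rewrite f₀≡1 = refl
*-inverseʳ f f₀≡1 (suc n) = begin
  f 0 ℤ.* (ℤ.- s) ℤ.+ sumℤ {suc n} (λ i → f (suc (toℕ i)) ℤ.* inverse f (n ∸ toℕ i))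
    ≡⟨ cong₂ ℤ._+_ (trans (cong (ℤ._* (ℤ.- s)) f₀≡1) (ℤ.*-identityˡ (ℤ.- s)))
         (sum-cong-≗ {suc n} λ i → cong (f (suc (toℕ i)) ℤ.*_) (sym (inverseTo-inverse f n i))) ⟩
  ℤ.- s ℤ.+ s
    ≡⟨ ℤ.+-inverseˡ s ⟩
  0ℤ ∎
  where
  open ≡-Reasoning
  s = sumℤ {suc n} (λ i → f (suc (toℕ i)) ℤ.* inverseTo f n i)

-- Convergence in the q-adic topology: each coefficient of the partial
-- sums is eventually constant.
infix 4 _SumsTo_
_SumsTo_ : (ℕ → PowerSeries) → PowerSeries → Set
f SumsTo s =
  ∀ k → ∃[ M ] ∀ m → M ≤ m → sum {m} (λ n → f (toℕ n)) k ≡ s k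

-- pochhammer a x n = (a;x)ₙ
pochhammer : PowerSeries → PowerSeries → ℕ → PowerSeries
pochhammer a x zero    = 1#
pochhammer a x (suc n) = pochhammer a x n * (1# - a * x ^ n)

-- A partition is the list of its parts in weakly increasing order.
IsPartition : List ℕ → Set
IsPartition β = All (0 <_) β × Linked _≤_ β

-- Condition on consecutive parts b, c.  Partitions being weakly
-- increasing, the truncated subtraction is the true difference.
Step : ℕ → ℕ → Set
Step b c = (¬ 2 ∣ c → 3 ≤ c ∸ b × c ∸ b ≤ 4)
         × (2 ∣ c → 0 ≤ c ∸ b × c ∸ b ≤ 1)

-- The empty partition belongs to 𝓑𝓔, the condition on β₁ being vacuous.
𝓑𝓔 : List ℕ → Set
𝓑𝓔 β = IsPartition β
     × Maybe.All (λ b → b ≡ 2 ⊎ b ≡ 3) (head β)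
     × Linked Step β

step? : Binary.Decidable Step
step? b c = (¬? (2 ∣? c) →-dec 3 ℕ.≤? c ∸ b ×-dec c ∸ b ℕ.≤? 4)
      ×-dec (2 ∣? c →-dec 0 ℕ.≤? c ∸ b ×-dec c ∸ b ℕ.≤? 1)

𝓑𝓔? : Decidable 𝓑𝓔
𝓑𝓔? β = (All.all? (0 ℕ.<?_) β ×-dec linked? ℕ._≤?_ β)
  ×-dec Maybe.dec (λ b → b ℕ.≟ 2 ⊎-dec b ℕ.≟ 3) (head β)
  ×-dec linked? step? β

-- All lists of n naturals, each at most N.
lists : ℕ → ℕ → List (List ℕ)
lists zero    N = [] ∷ []
lists (suc n) N = cartesianProductWith _∷_ (upTo (suc N)) (lists n N)

𝓑𝓔-of-weight? : ∀ N → Decidable (λ β → 𝓑𝓔 β × weight β ≡ N)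
𝓑𝓔-of-weight? N β = 𝓑𝓔? β ×-dec weight β ℕ.≟ N

-- The elements of 𝓑𝓔 with n parts and weight N; see ∈-𝓑𝓔-list and
-- 𝓑𝓔-list-unique.
𝓑𝓔-list : ℕ → ℕ → List (List ℕ)
𝓑𝓔-list n N = filter (𝓑𝓔-of-weight? N) (lists n N)

-- Σ q^|β| over β ∈ 𝓑𝓔 with n parts.
b𝓔 : ℕ → PowerSeries
b𝓔 n N = ℤ.+ length (𝓑𝓔-list n N)

b𝓔-zero : b𝓔 0 ≈ 1#
b𝓔-zero zero    = refl
b𝓔-zero (suc _) = refl

∈-lists⁺ : ∀ {N} β → weight β ≤ N → β ∈ lists (length β) N
∈-lists⁺ []      _ = here refl
∈-lists⁺ (b ∷ β) p = ∈-cartesianProductWith⁺ _∷_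
  (∈-upTo⁺ (s≤s (ℕ.m+n≤o⇒m≤o b p))) (∈-lists⁺ β (ℕ.m+n≤o⇒n≤o b p))

∈-lists⁻ : ∀ n {N β} → β ∈ lists n N → length β ≡ n
∈-lists⁻ zero    (here refl) = refl
∈-lists⁻ (suc n) {N} β∈
  with _ , _ , _ , γ∈ , refl ← ∈-cartesianProductWith⁻ _∷_ (upTo (suc N)) (lists n N) β∈
  = cong suc (∈-lists⁻ n γ∈)

∈-𝓑𝓔-list : ∀ {n N β} → β ∈ 𝓑𝓔-list n N ⇔ (𝓑𝓔 β × length β ≡ n × weight β ≡ N)
∈-𝓑𝓔-list {n} {N} {β} = mk⇔
  (λ β∈ → let β∈lists , β∈𝓑𝓔 , eq = ∈-filter⁻ (𝓑𝓔-of-weight? N) {xs = lists n N} β∈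
          in β∈𝓑𝓔 , ∈-lists⁻ n β∈lists , eq)
  (λ { (β∈𝓑𝓔 , refl , refl) → ∈-filter⁺ (𝓑𝓔-of-weight? N) (∈-lists⁺ β ℕ.≤-refl) (β∈𝓑𝓔 , refl) })

lists-unique : ∀ n N → Unique (lists n N)
lists-unique zero    N = [] ∷ []
lists-unique (suc n) N =
  Unique.cartesianProductWith⁺ _∷_ ∷-injective (Unique.upTo⁺ (suc N)) (lists-unique n N)

𝓑𝓔-list-unique : ∀ n N → Unique (𝓑𝓔-list n N)
𝓑𝓔-list-unique n N = Unique.filter⁺ (𝓑𝓔-of-weight? N) (lists-unique n N)

-- The denominators (q²;q²)ₙ have constant coefficient 1, so that
-- dividing by them is meaningful.

*-constant : ∀ f g → (f * g) 0 ≡ f 0 ℤ.* g 0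
*-constant f g = ℤ.+-identityʳ _

pochhammer-constant : ∀ a x n → a 0 ≡ 0ℤ → pochhammer a x n 0 ≡ 1ℤ
pochhammer-constant a x zero    a₀≡0 = refl
pochhammer-constant a x (suc n) a₀≡0
  rewrite *-constant (pochhammer a x n) (1# - a * x ^ n)
        | pochhammer-constant a x n a₀≡0
        | *-constant a (x ^ n)
        | a₀≡0
        = refl

{-# OPTIONS --safe #-}

-- The identity holds term by term.  After a part b the next part is e or
-- e + 3, where e is the least even number ≥ b; the next even ceiling is e or
-- e + 4 accordingly.  Hence every choice of the larger part contributes 3 to
-- its own part and 4 to each later one, so the n parts following b have the
-- generating function q^{en} (-q³;q⁴)ₙ.  Starting from 2 or 3 gives
-- b𝓔(n) = (-q³;q⁴)ₙ₋₁ q²ⁿ (1 + q²ⁿ⁻¹) for n ≥ 1, and both series converge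
-- because this is divisible by q²ⁿ.

module Submission where

open import Defs
open import Data.Nat.Base as ℕ using (ℕ; _∸_)
open import Data.Product.Base using (_×_; ∃-syntax)

open import Algebra.Bundles using (CommutativeRing)
import Algebra.Construct.Pointwise as Pointwise
open import Algebra.Structures using (IsCommutativeRing)
open import Data.Fin.Base using (toℕ)
open import Data.Integer.Base as ℤ using (ℤ; 0ℤ; 1ℤ)
import Data.Integer.Properties as ℤ
open import Data.Integer.Tactic.RingSolver using (solve-∀)
open import Data.List.Base using (List; []; _∷_; _++_; map; length; filter)
open import Data.List.Membership.Propositional using (_∈_)
open import Data.List.Membership.Propositional.Properties
  using (∈-map⁺; ∈-map⁻; ∈-++⁺ˡ; ∈-++⁺ʳ; ∈-++⁻; ∈-filter⁺; ∈-filter⁻)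
open import Data.List.Membership.Propositional.Properties.WithK using (unique∧set⇒bag)
open import Data.List.Properties using (∷-injectiveˡ; ∷-injectiveʳ; filter-accept; filter-reject)
open import Data.List.Relation.Binary.BagAndSetEquality using (∼bag⇒↭)
open import Data.List.Relation.Binary.Permutation.Propositional.Properties using (↭-length)
open import Data.List.Relation.Unary.All using ([])
open import Data.List.Relation.Unary.AllPairs using ([]; _∷_)
open import Data.List.Relation.Unary.Any using (here)
open import Data.List.Relation.Unary.Linked as Linked using (Linked; []; [-]; _∷_)
open import Data.List.Relation.Unary.Linked.Properties using (Linked⇒All)
open import Data.List.Relation.Unary.Unique.Propositional using (Unique)
import Data.List.Relation.Unary.Unique.Propositional.Properties as Unique
open import Data.Maybe.Relation.Unary.All using (just; nothing)
open import Data.Nat.Base using (zero; suc; _≤_; _<_; z≤n; s≤s)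
open import Data.Nat.Divisibility using (_∣_; _∣?_; ∣-refl; ∣m+n∣m⇒∣n; ∣m∣n⇒∣m+n)
open import Data.Nat.ListAction using () renaming (sum to weight)
import Data.Nat.Properties as ℕ
open import Data.Nat.Tactic.RingSolver using () renaming (solve-∀ to ℕ-solve-∀)
open import Data.Product.Base using (_,_)
open import Data.Sum.Base as Sum using (_⊎_; inj₁; inj₂)
open import Function.Base using (_∘_)
open import Function.Bundles using (mk⇔; Equivalence)
open import Level using (0ℓ)
open import Relation.Binary.PropositionalEquality as ≡ using (_≡_; _≢_; refl; cong; cong₂)
open import Relation.Nullary using (Dec; yes; no)
open import Relation.Nullary.Decidable using (from-yes; from-no)

-- The ring of power series

tail : PowerSeries → PowerSeries
tail f = f ∘ suc

infixl 7 _·_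
_·_ : ℤ → PowerSeries → PowerSeries
(c · f) n = c ℤ.* f n

-- The proofs of the ring laws all rest on the recurrence
-- (f * g) (suc n) = f 0 * g (suc n) + (tail f * g) n, which holds
-- definitionally.

*-cong : ∀ {f f′ g g′} → f ≈ f′ → g ≈ g′ → f * g ≈ f′ * g′
*-cong p r zero    = cong (ℤ._+ 0ℤ) (cong₂ ℤ._*_ (p 0) (r 0))
*-cong p r (suc n) =
  cong₂ ℤ._+_ (cong₂ ℤ._*_ (p 0) (r (suc n))) (*-cong (p ∘ suc) r n)

*-distribʳ : ∀ f g h → (g + h) * f ≈ g * f + h * f
*-distribʳ f g h zero    = lemma (g 0) (h 0) (f 0)
  where
  lemma : ∀ a b c → (a ℤ.+ b) ℤ.* c ℤ.+ 0ℤ ≡ (a ℤ.* c ℤ.+ 0ℤ) ℤ.+ (b ℤ.* c ℤ.+ 0ℤ)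
  lemma = solve-∀
*-distribʳ f g h (suc n) = ≡.trans
  (cong (λ x → (g 0 ℤ.+ h 0) ℤ.* f (suc n) ℤ.+ x) (*-distribʳ f (tail g) (tail h) n))
  (lemma (g 0) (h 0) (f (suc n)) ((tail g * f) n) ((tail h * f) n))
  where
  lemma : ∀ a b c x y →
          (a ℤ.+ b) ℤ.* c ℤ.+ (x ℤ.+ y) ≡ (a ℤ.* c ℤ.+ x) ℤ.+ (b ℤ.* c ℤ.+ y)
  lemma = solve-∀

-- Serves `*-assoc`: by the recurrence `tail (f * g)` is `f 0 · tail g + tail f * g`, so a scalar
-- multiple appears as the left factor of a product.
·-* : ∀ c f g → (c · f) * g ≈ c · (f * g)
·-* c f g zero    = lemma c (f 0) (g 0)
  where
  lemma : ∀ a b c → a ℤ.* b ℤ.* c ℤ.+ 0ℤ ≡ a ℤ.* (b ℤ.* c ℤ.+ 0ℤ)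
  lemma = solve-∀
·-* c f g (suc n) = ≡.trans
  (cong (λ x → c ℤ.* f 0 ℤ.* g (suc n) ℤ.+ x) (·-* c (tail f) g n))
  (lemma c (f 0) (g (suc n)) ((tail f * g) n))
  where
  lemma : ∀ a b c x → a ℤ.* b ℤ.* c ℤ.+ a ℤ.* x ≡ a ℤ.* (b ℤ.* c ℤ.+ x)
  lemma = solve-∀

-- The mirror image of the recurrence, splitting off the last term of the convolution instead of the
-- first. Exchanging the factors turns one recurrence into the other, which is the inductive step of
-- `*-comm`.
*-tailʳ : ∀ f g n → (f * g) (suc n) ≡ (f * tail g) n ℤ.+ f (suc n) ℤ.* g 0
*-tailʳ f g zero    = lemma (f 0 ℤ.* g 1) (f 1 ℤ.* g 0)
  where
  lemma : ∀ a b → a ℤ.+ (b ℤ.+ 0ℤ) ≡ (a ℤ.+ 0ℤ) ℤ.+ b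
  lemma = solve-∀
*-tailʳ f g (suc n) = ≡.trans
  (cong (λ x → f 0 ℤ.* g (suc (suc n)) ℤ.+ x) (*-tailʳ (tail f) g n))
  (≡.sym (ℤ.+-assoc (f 0 ℤ.* g (suc (suc n))) _ _))

*-comm : ∀ f g → f * g ≈ g * f
*-comm f g zero    = cong (ℤ._+ 0ℤ) (ℤ.*-comm (f 0) (g 0))
*-comm f g (suc n) = begin
  f 0 ℤ.* g (suc n) ℤ.+ (tail f * g) n
    ≡⟨ ℤ.+-comm (f 0 ℤ.* g (suc n)) _ ⟩
  (tail f * g) n ℤ.+ f 0 ℤ.* g (suc n)
    ≡⟨ cong₂ ℤ._+_ (*-comm (tail f) g n) (ℤ.*-comm (f 0) (g (suc n))) ⟩
  (g * tail f) n ℤ.+ g (suc n) ℤ.* f 0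
    ≡⟨ *-tailʳ g f n ⟨
  (g * f) (suc n) ∎
  where open ≡.≡-Reasoning

*-assoc : ∀ f g h → (f * g) * h ≈ f * (g * h)
*-assoc f g h zero    = lemma (f 0) (g 0) (h 0)
  where
  lemma : ∀ a b c → (a ℤ.* b ℤ.+ 0ℤ) ℤ.* c ℤ.+ 0ℤ ≡ a ℤ.* (b ℤ.* c ℤ.+ 0ℤ) ℤ.+ 0ℤ
  lemma = solve-∀
*-assoc f g h (suc n) = begin
  (f * g) 0 ℤ.* h (suc n) ℤ.+ (tail (f * g) * h) n
    ≡⟨ cong (λ x → (f * g) 0 ℤ.* h (suc n) ℤ.+ x) (*-distribʳ h (f 0 · tail g) (tail f * g) n) ⟩
  (f * g) 0 ℤ.* h (suc n) ℤ.+ (((f 0 · tail g) * h) n ℤ.+ (tail f * g * h) n)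
    ≡⟨ cong (λ x → (f * g) 0 ℤ.* h (suc n) ℤ.+ x)
         (cong₂ ℤ._+_ (·-* (f 0) (tail g) h n) (*-assoc (tail f) g h n)) ⟩
  (f * g) 0 ℤ.* h (suc n) ℤ.+ (f 0 ℤ.* (tail g * h) n ℤ.+ (tail f * (g * h)) n)
    ≡⟨ lemma (f 0) (g 0) (h (suc n)) ((tail g * h) n) ((tail f * (g * h)) n) ⟩
  f 0 ℤ.* (g * h) (suc n) ℤ.+ (tail f * (g * h)) n ∎
  where
  open ≡.≡-Reasoning
  lemma : ∀ a b c x y → (a ℤ.* b ℤ.+ 0ℤ) ℤ.* c ℤ.+ (a ℤ.* x ℤ.+ y) ≡ a ℤ.* (b ℤ.* c ℤ.+ x) ℤ.+ y
  lemma = solve-∀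

*-zeroˡ : ∀ f → 0# * f ≈ 0#
*-zeroˡ f zero    = refl
*-zeroˡ f (suc n) = ≡.trans (ℤ.+-identityˡ _) (*-zeroˡ f n)

*-identityˡ : ∀ f → 1# * f ≈ f
*-identityˡ f zero    = lemma (f 0)
  where
  lemma : ∀ a → 1ℤ ℤ.* a ℤ.+ 0ℤ ≡ a
  lemma = solve-∀
*-identityˡ f (suc n) = ≡.trans
  (cong₂ ℤ._+_ (ℤ.*-identityˡ (f (suc n))) (*-zeroˡ f n))
  (ℤ.+-identityʳ (f (suc n)))

+-*-isCommutativeRing : IsCommutativeRing _≈_ _+_ _*_ -_ 0# 1#
+-*-isCommutativeRing = record
  { isRing = record
    { +-isAbelianGroup = Pointwise.isAbelianGroup ℕ ℤ.+-0-isAbelianGroup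
    ; *-cong           = *-cong
    ; *-assoc          = *-assoc
    ; *-identity       = *-identityˡ , λ f n → ≡.trans (*-comm f 1# n) (*-identityˡ f n)
    ; distrib          = *-distribˡ , *-distribʳ
    }
  ; *-comm = *-comm
  }
  where
  *-distribˡ : ∀ f g h → f * (g + h) ≈ f * g + f * h
  *-distribˡ f g h n = ≡.trans (*-comm f (g + h) n)
    (≡.trans (*-distribʳ f g h n) (cong₂ ℤ._+_ (*-comm g f n) (*-comm h f n)))

+-*-commutativeRing : CommutativeRing 0ℓ 0ℓ
+-*-commutativeRing = record { isCommutativeRing = +-*-isCommutativeRing }

private module R = CommutativeRing +-*-commutativeRing

open import Algebra.Properties.CommutativeSemiring.Exp R.commutativeSemiring
  using (^-congʳ; ^-homo-*; ^-assocʳ)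
open import Algebra.Properties.Ring R.ring using (-‿distribˡ-*; -‿involutive)
open import Algebra.Solver.Ring.NaturalCoefficients.Default R.commutativeSemiring
  using (solve; con; _:*_; _:+_; _:=_)
import Relation.Binary.Reasoning.Setoid R.setoid as ≈-Reasoning

-- Inverses and the coefficients of powers of `q`

-- Uniqueness of inverses in a commutative monoid, which avoids an induction on the recurrence
-- behind `inverse`. The constant coefficients enter through `*-inverseʳ`.
inverse-cong : ∀ {f g} → f 0 ≡ 1ℤ → g 0 ≡ 1ℤ → f ≈ g → inverse f ≈ inverse g
inverse-cong {f} {g} f₀≡1 g₀≡1 f≈g = begin
  inverse f                     ≈⟨ R.*-identityʳ (inverse f) ⟨
  inverse f * 1#                ≈⟨ R.*-congˡ {inverse f} (*-inverseʳ g g₀≡1) ⟨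
  inverse f * (g * inverse g)   ≈⟨ *-assoc (inverse f) g (inverse g) ⟨
  (inverse f * g) * inverse g   ≈⟨ R.*-congʳ {inverse g} (*-comm (inverse f) g) ⟩
  (g * inverse f) * inverse g   ≈⟨ R.*-congʳ {inverse g} (R.*-congʳ {inverse f} f≈g) ⟨
  (f * inverse f) * inverse g   ≈⟨ R.*-congʳ {inverse g} (*-inverseʳ f f₀≡1) ⟩
  1# * inverse g                ≈⟨ *-identityˡ (inverse g) ⟩
  inverse g                     ∎
  where open ≈-Reasoning

q*-suc : ∀ f n → (q * f) (suc n) ≡ f n
q*-suc f n = ≡.trans (ℤ.+-identityˡ _)
  (≡.trans (R.*-congʳ {f} tail-q n) (*-identityˡ f n))
  where
  tail-q : tail q ≈ 1#
  tail-q zero    = refl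
  tail-q (suc _) = refl

q^n-coefficient≡ : ∀ n → (q ^ n) n ≡ 1ℤ
q^n-coefficient≡ zero    = refl
q^n-coefficient≡ (suc n) = ≡.trans (q*-suc (q ^ n) n) (q^n-coefficient≡ n)

q^m-coefficient≢ : ∀ m n → m ≢ n → (q ^ m) n ≡ 0ℤ
q^m-coefficient≢ zero    zero    m≢n with () ← m≢n refl
q^m-coefficient≢ zero    (suc n) _   = refl
q^m-coefficient≢ (suc m) zero    _   = refl
q^m-coefficient≢ (suc m) (suc n) m≢n =
  ≡.trans (q*-suc (q ^ m) n) (q^m-coefficient≢ m n (m≢n ∘ cong suc))

-- Convergence

-- Divisibility by `q ^ m`, expressed through coefficients.
VanishesBelow : ℕ → PowerSeries → Set
VanishesBelow m f = ∀ k → k < m → f k ≡ 0ℤ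

q^-vanishes : ∀ m → VanishesBelow m (q ^ m)
q^-vanishes m k k<m = q^m-coefficient≢ m k (ℕ.<⇒≢ k<m ∘ ≡.sym)

-- The recurrence for the product shortens `f` and leaves `g` intact, so the hypothesis on `g`
-- passes unchanged through the induction. The other side then follows by commutativity.
*-vanishesʳ : ∀ {m} f g → VanishesBelow m g → VanishesBelow m (f * g)
*-vanishesʳ f g g↓ zero    0<m
  rewrite g↓ 0 0<m | ℤ.*-zeroʳ (f 0) = refl
*-vanishesʳ f g g↓ (suc k) k<m
  rewrite g↓ (suc k) k<m | ℤ.*-zeroʳ (f 0) =
  ≡.trans (ℤ.+-identityˡ _) (*-vanishesʳ (tail f) g g↓ k (ℕ.<-trans (ℕ.n<1+n k) k<m))

*-vanishesˡ : ∀ {m} f g → VanishesBelow m f → VanishesBelow m (f * g)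
*-vanishesˡ f g f↓ k k<m = ≡.trans (*-comm f g k) (*-vanishesʳ g f f↓ k k<m)

partialSum : (ℕ → PowerSeries) → ℕ → PowerSeries
partialSum f m = sum {m} (λ n → f (toℕ n))

partialSum-cong : ∀ {f g : ℕ → PowerSeries} → (∀ n → f n ≈ g n) →
                  ∀ m → partialSum f m ≈ partialSum g m
partialSum-cong f≈g zero    k = refl
partialSum-cong f≈g (suc m) k = cong₂ ℤ._+_ (f≈g 0 k) (partialSum-cong (f≈g ∘ suc) m k)

partialSum-stable : ∀ f {M m} k → (∀ n → M ≤ n → f n k ≡ 0ℤ) → M ≤ m →
                    partialSum f m k ≡ partialSum f M k
partialSum-stable f {m = zero}  k f↓ z≤n = refl
partialSum-stable f {m = suc m} k f↓ z≤n
  rewrite f↓ 0 z≤n = ≡.trans (ℤ.+-identityˡ _)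
    (partialSum-stable (f ∘ suc) k (λ n _ → f↓ (suc n) z≤n) (z≤n {m}))
partialSum-stable f k f↓ (s≤s M≤m) = cong (λ x → f 0 k ℤ.+ x)
  (partialSum-stable (f ∘ suc) k (λ n M≤n → f↓ (suc n) (s≤s M≤n)) M≤m)

-- The sum of the series when `f n` is divisible by `q ^ n`: terms of index above `k` do not reach
-- coefficient `k`, so the first `suc k` terms determine it.
limit : (ℕ → PowerSeries) → PowerSeries
limit f k = partialSum f (suc k) k

SumsTo-limit : ∀ f → (∀ n → VanishesBelow n (f n)) → f SumsTo limit f
SumsTo-limit f f↓ k =
  suc k , λ m k<m → partialSum-stable f k (λ n k<n → f↓ n k k<n) k<m

-- Enumeration of 𝓑𝓔

-- Recursion by two matches the invariance of `Step` under adding 2 to both parts, on which the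
-- proofs about successors rest.
evenCeiling : ℕ → ℕ
evenCeiling 0             = 0
evenCeiling 1             = 2
evenCeiling (suc (suc b)) = 2 ℕ.+ evenCeiling b

evenCeiling-idem : ∀ b → evenCeiling (evenCeiling b) ≡ evenCeiling b
evenCeiling-idem 0             = refl
evenCeiling-idem 1             = refl
evenCeiling-idem (suc (suc b)) = cong (2 ℕ.+_) (evenCeiling-idem b)

evenCeiling-3+ : ∀ b → evenCeiling (3 ℕ.+ evenCeiling b) ≡ 4 ℕ.+ evenCeiling b
evenCeiling-3+ 0             = refl
evenCeiling-3+ 1             = refl
evenCeiling-3+ (suc (suc b)) = cong (2 ℕ.+_) (evenCeiling-3+ b)

-- Joining the order to `Step` makes the truncated difference genuine. `Linked.zip` and
-- `Linked.unzip` pass between chains of `↝` and the two separate conditions in `𝓑𝓔`.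
_↝_ : ℕ → ℕ → Set
b ↝ c = b ≤ c × Step b c

Successor : ℕ → ℕ → Set
Successor b c = c ≡ evenCeiling b ⊎ c ≡ 3 ℕ.+ evenCeiling b

2∣-+2 : ∀ {c} → 2 ∣ c → 2 ∣ 2 ℕ.+ c
2∣-+2 = ∣m∣n⇒∣m+n ∣-refl

2∣-∸2 : ∀ {c} → 2 ∣ 2 ℕ.+ c → 2 ∣ c
2∣-∸2 2∣2+c = ∣m+n∣m⇒∣n 2∣2+c ∣-refl

-- Adding 2 to both parts preserves order, difference and parity, so everything reduces to `b = 0`
-- and `b = 1`. There the few `c` with difference at most 4 are checked one by one, and a difference
-- of 5 or more is too large for either parity.
↝⇒Successor : ∀ b c → b ↝ c → Successor b c
↝⇒Successor 0 0 _ = inj₁ refl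
↝⇒Successor 0 1 (_ , odd , _) with s≤s () , _ ← odd (from-no (2 ∣? 1))
↝⇒Successor 0 2 (_ , _ , even) with _ , s≤s () ← even (from-yes (2 ∣? 2))
↝⇒Successor 0 3 _ = inj₂ refl
↝⇒Successor 0 4 (_ , _ , even) with _ , s≤s () ← even (from-yes (2 ∣? 4))
↝⇒Successor 0 (suc (suc (suc (suc (suc c))))) (_ , odd , even) with 2 ∣? 5 ℕ.+ c
... | yes 2∣c with _ , s≤s () ← even 2∣c
... | no 2∤c with _ , s≤s (s≤s (s≤s (s≤s ()))) ← odd 2∤c
↝⇒Successor 1 2 _ = inj₁ refl
↝⇒Successor 1 1 (_ , odd , _) with () , _ ← odd (from-no (2 ∣? 1))
↝⇒Successor 1 3 (_ , odd , _) with s≤s (s≤s ()) , _ ← odd (from-no (2 ∣? 3))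
↝⇒Successor 1 4 (_ , _ , even) with _ , s≤s () ← even (from-yes (2 ∣? 4))
↝⇒Successor 1 5 _ = inj₂ refl
↝⇒Successor 1 (suc (suc (suc (suc (suc (suc c)))))) (_ , odd , even) with 2 ∣? 6 ℕ.+ c
... | yes 2∣c with _ , s≤s () ← even 2∣c
... | no 2∤c with _ , s≤s (s≤s (s≤s (s≤s ()))) ← odd 2∤c
↝⇒Successor (suc (suc b)) (suc (suc c)) (s≤s (s≤s b≤c) , odd , even) =
  Sum.map (cong (2 ℕ.+_)) (cong (2 ℕ.+_))
    -- The differences agree by computation; only the parity hypotheses are transported, the negated
    -- one in the opposite direction.
    (↝⇒Successor b c (b≤c , odd ∘ (_∘ 2∣-∸2) , even ∘ 2∣-+2))

2+-mono-↝ : ∀ {b c} → b ↝ c → (2 ℕ.+ b) ↝ (2 ℕ.+ c)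
2+-mono-↝ (b≤c , odd , even) = s≤s (s≤s b≤c) , odd ∘ (_∘ 2∣-+2) , even ∘ 2∣-∸2

↝-evenCeiling : ∀ b → b ↝ evenCeiling b
↝-evenCeiling 0             = from-yes (0 ℕ.≤? 0) , from-yes (step? 0 0)
↝-evenCeiling 1             = from-yes (1 ℕ.≤? 2) , from-yes (step? 1 2)
↝-evenCeiling (suc (suc b)) = 2+-mono-↝ (↝-evenCeiling b)

↝-3+evenCeiling : ∀ b → b ↝ (3 ℕ.+ evenCeiling b)
↝-3+evenCeiling 0             = from-yes (0 ℕ.≤? 3) , from-yes (step? 0 3)
↝-3+evenCeiling 1             = from-yes (1 ℕ.≤? 5) , from-yes (step? 1 5)
↝-3+evenCeiling (suc (suc b)) = 2+-mono-↝ (↝-3+evenCeiling b)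

Successor⇒↝ : ∀ {b c} → Successor b c → b ↝ c
Successor⇒↝ {b} (inj₁ refl) = ↝-evenCeiling b
Successor⇒↝ {b} (inj₂ refl) = ↝-3+evenCeiling b

-- The common shape of the choice of the first part, 2 or 3, and of every later choice. Membership,
-- uniqueness and generating functions are thus treated once for both.
branch : (ℕ → List (List ℕ)) → ℕ → ℕ → List (List ℕ)
branch F c d = map (c ∷_) (F c) ++ map (d ∷_) (F d)

∈-branch⁻ : ∀ F c d {β} → β ∈ branch F c d →
            ∃[ a ] ∃[ γ ] β ≡ a ∷ γ × (a ≡ c ⊎ a ≡ d) × γ ∈ F a
∈-branch⁻ F c d β∈ with ∈-++⁻ (map (c ∷_) (F c)) β∈
... | inj₁ β∈c = let γ , γ∈ , eq = ∈-map⁻ (c ∷_) β∈c in c , γ , eq , inj₁ refl , γ∈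
... | inj₂ β∈d = let γ , γ∈ , eq = ∈-map⁻ (d ∷_) β∈d in d , γ , eq , inj₂ refl , γ∈

∈-branch⁺ : ∀ F c d {a γ} → a ≡ c ⊎ a ≡ d → γ ∈ F a → (a ∷ γ) ∈ branch F c d
∈-branch⁺ F c d (inj₁ refl) γ∈ = ∈-++⁺ˡ (∈-map⁺ (c ∷_) γ∈)
∈-branch⁺ F c d (inj₂ refl) γ∈ = ∈-++⁺ʳ (map (c ∷_) (F c)) (∈-map⁺ (d ∷_) γ∈)

branch-unique : ∀ F {c d} → c ≢ d → (∀ a → Unique (F a)) → Unique (branch F c d)
branch-unique F {c} {d} c≢d F! = Unique.++⁺
  (Unique.map⁺ ∷-injectiveʳ (F! c)) (Unique.map⁺ ∷-injectiveʳ (F! d))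
  λ (β∈c , β∈d) → let _ , _ , β≡c∷ = ∈-map⁻ (c ∷_) β∈c
                      _ , _ , β≡d∷ = ∈-map⁻ (d ∷_) β∈d
                  in c≢d (∷-injectiveˡ (≡.trans (≡.sym β≡c∷) β≡d∷))

continuations : ℕ → ℕ → List (List ℕ)
continuations zero    b = [] ∷ []
continuations (suc n) b =
  branch (continuations n) (evenCeiling b) (3 ℕ.+ evenCeiling b)

𝓑𝓔-enumeration : ℕ → List (List ℕ)
𝓑𝓔-enumeration zero    = [] ∷ []
𝓑𝓔-enumeration (suc n) = branch (continuations n) 2 3

∈-continuations⁻ : ∀ n b {γ} → γ ∈ continuations n b →
                   length γ ≡ n × Linked _↝_ (b ∷ γ)
∈-continuations⁻ zero    b (here refl) = refl , [-]
∈-continuations⁻ (suc n) b γ∈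
  with a , γ , refl , succ , γ∈′ ← ∈-branch⁻ (continuations n) _ _ γ∈
  = let eq , linked = ∈-continuations⁻ n a γ∈′
    in cong suc eq , Successor⇒↝ succ ∷ linked

∈-continuations⁺ : ∀ {b} γ → Linked _↝_ (b ∷ γ) → γ ∈ continuations (length γ) b
∈-continuations⁺         []      _              = here refl
∈-continuations⁺ {b} (c ∷ γ) (b↝c ∷ linked) =
  ∈-branch⁺ (continuations (length γ)) _ _ (↝⇒Successor b c b↝c) (∈-continuations⁺ γ linked)

∈-𝓑𝓔-enumeration⁻ : ∀ n {β} → β ∈ 𝓑𝓔-enumeration n → 𝓑𝓔 β × length β ≡ n
∈-𝓑𝓔-enumeration⁻ zero    (here refl) = (([] , []) , nothing , []) , refl
∈-𝓑𝓔-enumeration⁻ (suc n) β∈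
  with a , γ , refl , a∈ , γ∈ ← ∈-branch⁻ (continuations n) 2 3 β∈
  = let eq , linked   = ∈-continuations⁻ n a γ∈
        ≤s , steps = Linked.unzip linked
    -- Positivity spreads from the first part to all others along the weakly increasing chain.
    in ((Linked⇒All ℕ.≤-trans (0<a a∈) ≤s , ≤s) , just a∈ , steps) , cong suc eq
  where
  0<a : ∀ {a} → a ≡ 2 ⊎ a ≡ 3 → 0 < a
  0<a (inj₁ refl) = s≤s z≤n
  0<a (inj₂ refl) = s≤s z≤n

∈-𝓑𝓔-enumeration⁺ : ∀ {β} → 𝓑𝓔 β → β ∈ 𝓑𝓔-enumeration (length β)
∈-𝓑𝓔-enumeration⁺ {[]}    _ = here refl
∈-𝓑𝓔-enumeration⁺ {b ∷ γ} ((_ , ≤s) , just b∈ , steps) =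
  ∈-branch⁺ (continuations (length γ)) 2 3 b∈ (∈-continuations⁺ γ (Linked.zip (≤s , steps)))

continuations-unique : ∀ n b → Unique (continuations n b)
continuations-unique zero    b = [] ∷ []
continuations-unique (suc n) b =
  -- With the implicit argument 2 this says that `e` differs from `3 + e`.
  branch-unique (continuations n) (ℕ.m≢1+n+m _ {2}) (continuations-unique n)

𝓑𝓔-enumeration-unique : ∀ n → Unique (𝓑𝓔-enumeration n)
𝓑𝓔-enumeration-unique zero    = [] ∷ []
𝓑𝓔-enumeration-unique (suc n) =
  branch-unique (continuations n) (λ ()) (continuations-unique n)

-- Two duplicate-free lists with the same members are permutations of each other and so have equal
-- length. This replaces the filtered search space in the definition of `b𝓔` by a list whose
-- recursive structure can be summed.
b𝓔-enumeration : ∀ n N →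
  b𝓔 n N ≡ ℤ.+ length (filter (λ β → weight β ℕ.≟ N) (𝓑𝓔-enumeration n))
b𝓔-enumeration n N = cong ℤ.+_ (↭-length (∼bag⇒↭ (unique∧set⇒bag
  (𝓑𝓔-list-unique n N)
  (Unique.filter⁺ weight≟N (𝓑𝓔-enumeration-unique n))
  (mk⇔ to from))))
  where
  weight≟N = λ β → weight β ℕ.≟ N
  to : ∀ {β} → β ∈ 𝓑𝓔-list n N → β ∈ filter weight≟N (𝓑𝓔-enumeration n)
  to β∈ with β∈𝓑𝓔 , refl , eq ← Equivalence.to (∈-𝓑𝓔-list {n} {N}) β∈
    = ∈-filter⁺ weight≟N (∈-𝓑𝓔-enumeration⁺ β∈𝓑𝓔) eq
  from : ∀ {β} → β ∈ filter weight≟N (𝓑𝓔-enumeration n) → β ∈ 𝓑𝓔-list n N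
  from β∈ =
    let β∈enum , eq    = ∈-filter⁻ weight≟N {xs = 𝓑𝓔-enumeration n} β∈
        β∈𝓑𝓔 , len = ∈-𝓑𝓔-enumeration⁻ n β∈enum
    in Equivalence.from (∈-𝓑𝓔-list {n} {N}) (β∈𝓑𝓔 , len , eq)

-- Generating functions

generatingFunction : List (List ℕ) → PowerSeries
generatingFunction []       = 0#
generatingFunction (β ∷ βs) = q ^ weight β + generatingFunction βs

generatingFunction-coefficient : ∀ βs N →
  generatingFunction βs N ≡ ℤ.+ length (filter (λ β → weight β ℕ.≟ N) βs)
generatingFunction-coefficient []       N = refl
generatingFunction-coefficient (β ∷ βs) N = lemma (weight β ℕ.≟ N)
  where
  open ≡.≡-Reasoning
  weight≟N = λ β → weight β ℕ.≟ N
  lemma : Dec (weight β ≡ N) →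
          generatingFunction (β ∷ βs) N ≡ ℤ.+ length (filter weight≟N (β ∷ βs))
  lemma (yes refl) = begin
    (q ^ N) N ℤ.+ generatingFunction βs N
      ≡⟨ cong₂ ℤ._+_ (q^n-coefficient≡ N) (generatingFunction-coefficient βs N) ⟩
    ℤ.+ length (β ∷ filter weight≟N βs)
      ≡⟨ cong (ℤ.+_ ∘ length) (filter-accept weight≟N {β} {βs} refl) ⟨
    ℤ.+ length (filter weight≟N (β ∷ βs)) ∎
  lemma (no w≢N) = begin
    (q ^ weight β) N ℤ.+ generatingFunction βs N
      ≡⟨ cong₂ ℤ._+_ (q^m-coefficient≢ (weight β) N w≢N) (generatingFunction-coefficient βs N) ⟩
    ℤ.+ length (filter weight≟N βs)
      ≡⟨ cong (ℤ.+_ ∘ length) (filter-reject weight≟N {β} {βs} w≢N) ⟨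
    ℤ.+ length (filter weight≟N (β ∷ βs)) ∎

generatingFunction-++ : ∀ βs γs →
  generatingFunction (βs ++ γs) ≈ generatingFunction βs + generatingFunction γs
generatingFunction-++ []       γs k = ≡.sym (ℤ.+-identityˡ _)
generatingFunction-++ (β ∷ βs) γs k = ≡.trans
  (cong (λ x → (q ^ weight β) k ℤ.+ x) (generatingFunction-++ βs γs k))
  (≡.sym (ℤ.+-assoc ((q ^ weight β) k) _ _))

generatingFunction-map-∷ : ∀ b βs →
  generatingFunction (map (b ∷_) βs) ≈ q ^ b * generatingFunction βs
generatingFunction-map-∷ b []       = R.sym {q ^ b * 0#} {0#} (R.zeroʳ (q ^ b))
generatingFunction-map-∷ b (β ∷ βs) = begin
  q ^ (b ℕ.+ weight β) + generatingFunction (map (b ∷_) βs)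
    ≈⟨ R.+-cong (^-homo-* q b (weight β)) (generatingFunction-map-∷ b βs) ⟩
  q ^ b * q ^ weight β + q ^ b * generatingFunction βs
    ≈⟨ R.distribˡ (q ^ b) (q ^ weight β) (generatingFunction βs) ⟨
  q ^ b * (q ^ weight β + generatingFunction βs) ∎
  where open ≈-Reasoning

generatingFunction-branch : ∀ F c d {f g} →
  generatingFunction (F c) ≈ f → generatingFunction (F d) ≈ g →
  generatingFunction (branch F c d) ≈ q ^ c * f + q ^ d * g
generatingFunction-branch F c d {f} {g} p r = begin
  generatingFunction (map (c ∷_) (F c) ++ map (d ∷_) (F d))
    ≈⟨ generatingFunction-++ (map (c ∷_) (F c)) (map (d ∷_) (F d)) ⟩
  generatingFunction (map (c ∷_) (F c)) + generatingFunction (map (d ∷_) (F d))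
    ≈⟨ R.+-cong (generatingFunction-map-∷ c (F c)) (generatingFunction-map-∷ d (F d)) ⟩
  q ^ c * generatingFunction (F c) + q ^ d * generatingFunction (F d)
    ≈⟨ R.+-cong (R.*-congˡ {q ^ c} p) (R.*-congˡ {q ^ d} r) ⟩
  q ^ c * f + q ^ d * g ∎
  where open ≈-Reasoning

-- The product formula for `b𝓔`

stepProduct : ℕ → PowerSeries
stepProduct = pochhammer (- (q ^ 3)) (q ^ 4)

-- The two signs cancel. In the enumeration the last factor belongs to the earliest choice: the
-- larger part costs 3 itself and 4 for each of the `n` parts after it.
stepProduct-suc : ∀ n → stepProduct (suc n) ≈ stepProduct n * (1# + q ^ 3 * (q ^ 4) ^ n)
stepProduct-suc n = R.*-congˡ {stepProduct n} (R.+-congˡ {1#} (begin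
  - (- (q ^ 3) * (q ^ 4) ^ n)  ≈⟨ R.-‿cong (-‿distribˡ-* (q ^ 3) ((q ^ 4) ^ n)) ⟨
  - (- (q ^ 3 * (q ^ 4) ^ n))  ≈⟨ -‿involutive (q ^ 3 * (q ^ 4) ^ n) ⟩
  q ^ 3 * (q ^ 4) ^ n          ∎))
  where open ≈-Reasoning

-- Induction on `n` for all `b` at once, because the hypothesis is applied at `e` and at `3 + e`.
-- Their even ceilings are `e` and `4 + e`, so the two branches share `q ^ (e * n)` and differ by
-- `(q ^ 4) ^ n`.
generatingFunction-continuations : ∀ n b →
  generatingFunction (continuations n b) ≈ q ^ (evenCeiling b ℕ.* n) * stepProduct n
generatingFunction-continuations zero    b rewrite ℕ.*-zeroʳ (evenCeiling b) = begin
  1# + 0#  ≈⟨ R.+-identityʳ 1# ⟩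
  1#       ≈⟨ *-identityˡ 1# ⟨
  1# * 1#  ∎
  where open ≈-Reasoning
generatingFunction-continuations (suc n) b = begin
  generatingFunction (branch (continuations n) e (3 ℕ.+ e))
    ≈⟨ generatingFunction-branch (continuations n) e (3 ℕ.+ e) from-e from-3+e ⟩
  q ^ e * (q ^ (e ℕ.* n) * stepProduct n) + q ^ (3 ℕ.+ e) * ((q ^ 4) ^ n * q ^ (e ℕ.* n) * stepProduct n)
    ≈⟨ R.+-congˡ {q ^ e * (q ^ (e ℕ.* n) * stepProduct n)}
         (R.*-congʳ {(q ^ 4) ^ n * q ^ (e ℕ.* n) * stepProduct n} (^-homo-* q 3 e)) ⟩
  q ^ e * (q ^ (e ℕ.* n) * stepProduct n) + q ^ 3 * q ^ e * ((q ^ 4) ^ n * q ^ (e ℕ.* n) * stepProduct n)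
    ≈⟨ solve 5 (λ X Y P A Z → X :* (Y :* P) :+ A :* X :* (Z :* Y :* P)
                           := X :* Y :* (P :* (con 1 :+ A :* Z)))
         (λ _ → refl) (q ^ e) (q ^ (e ℕ.* n)) (stepProduct n) (q ^ 3) ((q ^ 4) ^ n) ⟩
  q ^ e * q ^ (e ℕ.* n) * (stepProduct n * (1# + q ^ 3 * (q ^ 4) ^ n))
    ≈⟨ *-cong (^-homo-* q e (e ℕ.* n)) (stepProduct-suc n) ⟨
  q ^ (e ℕ.+ e ℕ.* n) * stepProduct (suc n)
    ≈⟨ R.*-congʳ {stepProduct (suc n)} (^-congʳ q (ℕ.*-suc e n)) ⟨
  q ^ (e ℕ.* suc n) * stepProduct (suc n) ∎
  where
  open ≈-Reasoning
  e = evenCeiling b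
  from-e : generatingFunction (continuations n e) ≈ q ^ (e ℕ.* n) * stepProduct n
  from-e = begin
    generatingFunction (continuations n e) ≈⟨ generatingFunction-continuations n e ⟩
    q ^ (evenCeiling e ℕ.* n) * stepProduct n        ≡⟨ cong (λ c → q ^ (c ℕ.* n) * stepProduct n) (evenCeiling-idem b) ⟩
    q ^ (e ℕ.* n) * stepProduct n                    ∎
  from-3+e : generatingFunction (continuations n (3 ℕ.+ e)) ≈ (q ^ 4) ^ n * q ^ (e ℕ.* n) * stepProduct n
  from-3+e = begin
    generatingFunction (continuations n (3 ℕ.+ e))
      ≈⟨ generatingFunction-continuations n (3 ℕ.+ e) ⟩
    q ^ (evenCeiling (3 ℕ.+ e) ℕ.* n) * stepProduct n
      ≡⟨ cong (λ c → q ^ (c ℕ.* n) * stepProduct n) (evenCeiling-3+ b) ⟩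
    q ^ ((4 ℕ.+ e) ℕ.* n) * stepProduct n
      ≡⟨ cong (λ c → q ^ c * stepProduct n) (ℕ.*-distribʳ-+ n 4 e) ⟩
    q ^ (4 ℕ.* n ℕ.+ e ℕ.* n) * stepProduct n
      ≈⟨ R.*-congʳ {stepProduct n} (^-homo-* q (4 ℕ.* n) (e ℕ.* n)) ⟩
    q ^ (4 ℕ.* n) * q ^ (e ℕ.* n) * stepProduct n
      ≈⟨ R.*-congʳ {stepProduct n} (R.*-congʳ {q ^ (e ℕ.* n)} (^-assocʳ q 4 n)) ⟨
    (q ^ 4) ^ n * q ^ (e ℕ.* n) * stepProduct n ∎

-- Equal to b𝓔 n for n ≥ 1 only: at n = 0 the subtractions are truncated.
b𝓔-product : ℕ → PowerSeries
b𝓔-product n = stepProduct (n ∸ 1) * q ^ (2 ℕ.* n) * (1# + q ^ (2 ℕ.* n ∸ 1))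

-- The first parts 2 and 3 have even ceilings 2 and 4, giving the exponents 2 + 2n and 3 + 4n. With
-- m = n + 1 these are 2m and 2m + (2m - 1), whence the factor `1# + q ^ (2m - 1)`.
b𝓔-suc : ∀ n → b𝓔 (suc n) ≈ b𝓔-product (suc n)
b𝓔-suc n = begin
  b𝓔 (suc n)
    ≈⟨ b𝓔≈ ⟩
  generatingFunction (branch (continuations n) 2 3)
    ≈⟨ generatingFunction-branch (continuations n) 2 3
         (generatingFunction-continuations n 2) (generatingFunction-continuations n 3) ⟩
  q ^ 2 * (q ^ (2 ℕ.* n) * stepProduct n) + q ^ 3 * (q ^ (4 ℕ.* n) * stepProduct n)
    ≈⟨ R.+-cong (collect 2 (2 ℕ.* n) (2 ℕ.* suc n) (≡.sym (ℕ.*-suc 2 n)))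
                (collect 3 (4 ℕ.* n) (2 ℕ.* suc n ℕ.+ (2 ℕ.* suc n ∸ 1)) exponent) ⟩
  q ^ (2 ℕ.* suc n) * stepProduct n + q ^ (2 ℕ.* suc n ℕ.+ (2 ℕ.* suc n ∸ 1)) * stepProduct n
    ≈⟨ R.+-congˡ {q ^ (2 ℕ.* suc n) * stepProduct n}
         (R.*-congʳ {stepProduct n} (^-homo-* q (2 ℕ.* suc n) (2 ℕ.* suc n ∸ 1))) ⟩
  q ^ (2 ℕ.* suc n) * stepProduct n + q ^ (2 ℕ.* suc n) * q ^ (2 ℕ.* suc n ∸ 1) * stepProduct n
    ≈⟨ solve 3 (λ X W P → X :* P :+ X :* W :* P := P :* X :* (con 1 :+ W))
         (λ _ → refl) (q ^ (2 ℕ.* suc n)) (q ^ (2 ℕ.* suc n ∸ 1)) (stepProduct n) ⟩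
  b𝓔-product (suc n) ∎
  where
  open ≈-Reasoning
  b𝓔≈ : b𝓔 (suc n) ≈ generatingFunction (𝓑𝓔-enumeration (suc n))
  b𝓔≈ N = ≡.trans (b𝓔-enumeration (suc n) N)
    (≡.sym (generatingFunction-coefficient (𝓑𝓔-enumeration (suc n)) N))
  collect : ∀ a b c → a ℕ.+ b ≡ c → q ^ a * (q ^ b * stepProduct n) ≈ q ^ c * stepProduct n
  collect a b c a+b≡c = begin
    q ^ a * (q ^ b * stepProduct n)  ≈⟨ *-assoc (q ^ a) (q ^ b) (stepProduct n) ⟨
    q ^ a * q ^ b * stepProduct n    ≈⟨ R.*-congʳ {stepProduct n} (^-homo-* q a b) ⟨
    q ^ (a ℕ.+ b) * stepProduct n    ≡⟨ cong (λ c → q ^ c * stepProduct n) a+b≡c ⟩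
    q ^ c * stepProduct n            ∎
  exponent : 3 ℕ.+ 4 ℕ.* n ≡ 2 ℕ.* suc n ℕ.+ (2 ℕ.* suc n ∸ 1)
  exponent = lemma n
    where
    -- The last summand is what `2 * suc n ∸ 1` computes to; in this form the solver meets no
    -- truncated subtraction.
    lemma : ∀ n → 3 ℕ.+ 4 ℕ.* n ≡ 2 ℕ.* suc n ℕ.+ (n ℕ.+ (suc n ℕ.+ 0))
    lemma = ℕ-solve-∀

b𝓔-product-vanishes : ∀ n → VanishesBelow (2 ℕ.* n) (b𝓔-product n)
b𝓔-product-vanishes n = *-vanishesˡ (stepProduct (n ∸ 1) * q ^ (2 ℕ.* n)) (1# + q ^ (2 ℕ.* n ∸ 1))
  (*-vanishesʳ (stepProduct (n ∸ 1)) (q ^ (2 ℕ.* n)) (q^-vanishes (2 ℕ.* n)))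

-- Comparison of the two series

theorem16 : ∃[ L ] ∃[ R ]
    ((λ n → b𝓔 n / pochhammer (q ^ 2) (q ^ 2) n) SumsTo L)
    × ((λ k → let n = 2 ℕ.+ k in
    (pochhammer (- (q ^ 3)) (q ^ 4) (n ∸ 1) * q ^ (2 ℕ.* n) * (1# + q ^ (2 ℕ.* n ∸ 1)))
    / pochhammer (q ^ 2) (q ^ 2) n) SumsTo R)
    × L ≈ 1# + (q ^ 2 + q ^ 3) / (1# - q ^ 2) + R
theorem16 = limit l , limit r , SumsTo-limit l l-vanishes , SumsTo-limit r r-vanishes , l≈
  where
  D : ℕ → PowerSeries
  D = pochhammer (q ^ 2) (q ^ 2)

  l r : ℕ → PowerSeries
  l n = b𝓔 n / D n
  r k = b𝓔-product (2 ℕ.+ k) / D (2 ℕ.+ k)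

  l-suc : ∀ n → l (suc n) ≈ b𝓔-product (suc n) / D (suc n)
  l-suc n = R.*-congʳ {inverse (D (suc n))} (b𝓔-suc n)

  summand-vanishes : ∀ n → VanishesBelow (2 ℕ.* n) (b𝓔-product n / D n)
  summand-vanishes n =
    *-vanishesˡ (b𝓔-product n) (inverse (D n)) (b𝓔-product-vanishes n)

  l-vanishes : ∀ n → VanishesBelow n (l n)
  -- Index 0 is vacuous, so only indices at which `b𝓔-product` agrees with `b𝓔` arise.
  l-vanishes (suc n) k k<n =
    ≡.trans (l-suc n k) (summand-vanishes (suc n) k (ℕ.≤-trans k<n (ℕ.m≤m+n (suc n) _)))

  r-vanishes : ∀ n → VanishesBelow n (r n)
  r-vanishes n k k<n = summand-vanishes (2 ℕ.+ n) k
    (ℕ.≤-trans k<n (ℕ.≤-trans (ℕ.m≤n+m n 2) (ℕ.m≤m+n (2 ℕ.+ n) _)))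

  l₀ : l 0 ≈ 1#
  l₀ = begin
    b𝓔 0 * inverse 1#  ≈⟨ R.*-congʳ {inverse 1#} b𝓔-zero ⟩
    1# * inverse 1#    ≈⟨ *-inverseʳ 1# refl ⟩
    1#                 ∎
    where open ≈-Reasoning

  l₁ : l 1 ≈ (q ^ 2 + q ^ 3) / (1# - q ^ 2)
  l₁ = begin
    l 1                                ≈⟨ l-suc 0 ⟩
    b𝓔-product 1 / D 1                ≈⟨ *-cong numerator denominator ⟩
    (q ^ 2 + q ^ 3) / (1# - q ^ 2)     ∎
    where
    open ≈-Reasoning
    numerator : b𝓔-product 1 ≈ q ^ 2 + q ^ 3
    numerator = begin
      1# * q ^ 2 * (1# + q ^ 1)  ≈⟨ solve 2 (λ X W → con 1 :* X :* (con 1 :+ W) := X :+ X :* W)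
                                      (λ _ → refl) (q ^ 2) (q ^ 1) ⟩
      q ^ 2 + q ^ 2 * q ^ 1      ≈⟨ R.+-congˡ {q ^ 2} (^-homo-* q 2 1) ⟨
      q ^ 2 + q ^ 3              ∎
    D₁ : D 1 ≈ 1# - q ^ 2
    D₁ = begin
      1# * (1# - q ^ 2 * 1#)  ≈⟨ *-identityˡ (1# - q ^ 2 * 1#) ⟩
      1# - q ^ 2 * 1#         ≈⟨ R.+-congˡ {1#} (R.-‿cong (R.*-identityʳ (q ^ 2))) ⟩
      1# - q ^ 2              ∎
    denominator : inverse (D 1) ≈ inverse (1# - q ^ 2)
    denominator = inverse-cong (pochhammer-constant (q ^ 2) (q ^ 2) 1 refl) refl D₁

  l≈ : limit l ≈ 1# + (q ^ 2 + q ^ 3) / (1# - q ^ 2) + limit r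
  l≈ k = begin
    partialSum l (1 ℕ.+ k) k
      -- Stability, read backwards, lengthens the partial sum from `1 + k` to `3 + k` terms. Once
      -- terms 0 and 1 are split off, exactly the `1 + k` terms used by `limit r` remain.
      ≡⟨ partialSum-stable l k (λ n k<n → l-vanishes n k k<n) (ℕ.m≤n+m (1 ℕ.+ k) 2) ⟨
    l 0 k ℤ.+ (l 1 k ℤ.+ partialSum (λ n → l (2 ℕ.+ n)) (1 ℕ.+ k) k)
      ≡⟨ ℤ.+-assoc (l 0 k) (l 1 k) _ ⟨
    l 0 k ℤ.+ l 1 k ℤ.+ partialSum (λ n → l (2 ℕ.+ n)) (1 ℕ.+ k) k
      ≡⟨ cong₂ ℤ._+_ (cong₂ ℤ._+_ (l₀ k) (l₁ k)) (partialSum-cong (l-suc ∘ suc) (1 ℕ.+ k) k) ⟩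
    1# k ℤ.+ ((q ^ 2 + q ^ 3) / (1# - q ^ 2)) k ℤ.+ limit r k ∎
    where open ≡.≡-Reasoning
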